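{- Let $n \geq 1$ be an integer with $n \notin \{1, 2, 5\}$. Then the regular complete bipartite graph $K_{n,n}$ is not a geodesic Leech graph.
   Context: All graphs are finite, simple and undirected. A geodesic path in a graph $G$ is a path with at least one edge which is a shortest path in $G$ between its two end vertices; paths are undirected (a path and its reversal are the same path). The geodesic path number $t_{gp}(G)$ is the total number of geodesic paths in $G$. For an edge labeling $f : E(G) \to \{1,2,3,\dots\}$, the weight of a path $P$ is $w(P) = \sum_{e \in E(P)} f(e)$. The labeling $f$ is a geodesic Leech labeling of $G$ if the set of weights of the $t_{gp}(G)$ geodesic paths in $G$ is $\{1,2,\dots,t_{gp}(G)\}$ (so each of these values is the weight of exactly one geodesic path). A graph which admits a geodesic Leech labeling is called a geodesic Leech graph. -}

module Defs where

open import Data.Empty using (⊥)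
open import Data.Fin.Base using (Fin; zero; suc)
open import Data.Fin.Properties as Fin using (+↔⊎; injective⇒≤)
open import Data.List.Base as List
  using (List; []; _∷_; reverse; concatMap; allFin; lookup; deduplicate)
open import Data.List.Properties using (≡-dec; reverse-involutive)
open import Data.List.Membership.Propositional.Properties using (∈-allFin; ∈-lookup)
open import Data.List.Relation.Unary.All as All using (All; []; _∷_)
open import Data.List.Relation.Unary.AllPairs as AllPairs using ([]; _∷_)
open import Data.List.Relation.Unary.Any as Any using (Any; here; there)
import Data.List.Relation.Unary.Any.Properties as Anyₚ
open import Data.List.Relation.Unary.Enumerates.Setoid using (IsEnumeration)
open import Data.List.Relation.Unary.Enumerates.Setoid.Properties
  using (deduplicate⁺; lookup-surjective)
import Data.List.Relation.Unary.Unique.DecSetoid.Properties as UniqueDec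
open import Data.List.Relation.Unary.Unique.Propositional using (Unique)
import Data.List.Relation.Unary.Unique.Setoid as UniqueSetoid
open import Data.Nat.Base using (ℕ; zero; suc; _+_; _≤_; s≤s; z≤n)
open import Data.Nat.Properties as ℕ using (_≤?_)
open import Data.Product.Base using (∃; ∃-syntax; _×_; _,_; proj₁; proj₂)
open import Data.Sum.Base using (_⊎_; inj₁; inj₂)
open import Data.Unit.Base using (⊤)
open import Function.Base using (_∘_)
open import Function.Bundles using (_↔_; _⇔_; Inverse; Injection; Bijection)
open import Function.Construct.Symmetry using (↔-sym)
open import Function.Properties.Inverse using (↔⇒↣)
open import Level using (_⊔_; 0ℓ)
open import Relation.Binary.Bundles using (Setoid; DecSetoid)
open import Relation.Binary.Construct.Closure.ReflexiveTransitive using (Star; ε; _◅_)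
open import Relation.Binary.Definitions
  using (Decidable; DecidableEquality; Symmetric; Irreflexive)
open import Relation.Binary.PropositionalEquality as ≡
  using (_≡_; refl; sym; trans; cong; subst)
open import Relation.Nullary using (Dec; yes; no; contradiction)
open import Relation.Nullary.Decidable
  using (¬?; _×-dec_; _⊎-dec_; _→-dec_; map′; via-injection)

record Graph : Set₁ where
  field
    Vertex     : Set
    order      : ℕ
    enumerated : Vertex ↔ Fin order
    Adj        : Vertex → Vertex → Set
    adj?       : Decidable Adj
    adj-sym    : Symmetric Adj
    adj-irrefl : Irreflexive _≡_ Adj

  infix 4 _≟_
  _≟_ : DecidableEquality Vertex
  _≟_ = via-injection (↔⇒↣ enumerated) Fin._≟_

completeBipartite : ℕ → ℕ → Graph
completeBipartite m n = record
  { Vertex     = Fin m ⊎ Fin n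
  ; order      = m + n
  ; enumerated = ↔-sym +↔⊎
  ; Adj        = Across
  ; adj?       = λ { (inj₁ _) (inj₁ _) → no λ() ; (inj₁ _) (inj₂ _) → yes _
                   ; (inj₂ _) (inj₁ _) → yes _  ; (inj₂ _) (inj₂ _) → no λ() }
  ; adj-sym    = λ { {inj₁ _} {inj₂ _} _ → _ ; {inj₂ _} {inj₁ _} _ → _ }
  ; adj-irrefl = λ { {inj₁ _} refl () ; {inj₂ _} refl () }
  }
  where
  Across : Fin m ⊎ Fin n → Fin m ⊎ Fin n → Set
  Across (inj₁ _) (inj₁ _) = ⊥
  Across (inj₁ _) (inj₂ _) = ⊤
  Across (inj₂ _) (inj₁ _) = ⊤
  Across (inj₂ _) (inj₂ _) = ⊥

module _ (G : Graph) where
  open Graph G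

  -- The adjacency argument is irrelevant and the two orientations of an edge
  -- get the same label, so this is a function on the edge set.
  record EdgeLabeling : Set where
    field
      label          : ∀ u v → .(Adj u v) → ℕ
      label-sym      : ∀ u v .(uv : Adj u v) → label u v uv ≡ label v u (adj-sym uv)
      label-positive : ∀ u v .(uv : Adj u v) → 1 ≤ label u v uv

module _ {G : Graph} where
  open Graph G

  vertexSequence : ∀ {u v} → Star Adj u v → List Vertex
  vertexSequence {u} ε       = u ∷ []
  vertexSequence {u} (_ ◅ p) = u ∷ vertexSequence p

  length : ∀ {u v} → Star Adj u v → ℕ
  length ε       = 0
  length (_ ◅ p) = suc (length p)

  weight : EdgeLabeling G → ∀ {u v} → Star Adj u v → ℕ
  weight f ε                   = 0
  weight f (_◅_ {u} {v} uv p) = EdgeLabeling.label f u v uv + weight f p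

  IsPath : ∀ {u v} → Star Adj u v → Set
  IsPath p = Unique (vertexSequence p)

  record IsGeodesic {u v} (p : Star Adj u v) : Set where
    field
      isPath   : IsPath p
      nonempty : 1 ≤ length p
      shortest : (q : Star Adj u v) → IsPath q → length p ≤ length q

-- An oriented representative of a geodesic path; identification with the
-- reversed path is made by `geodesicPathSetoid` below.
record GeodesicPath (G : Graph) : Set where
  constructor geodesicPath
  field
    {source target} : Graph.Vertex G
    walk            : Star (Graph.Adj G) source target
    isGeodesic      : IsGeodesic {G} walk

  vertices : List (Graph.Vertex G)
  vertices = vertexSequence {G} walk

open GeodesicPath using (vertices)

module _ (G : Graph) where
  open Graph G using (Vertex)

  infix 4 _≈_
  _≈_ : GeodesicPath G → GeodesicPath G → Set
  P ≈ Q = vertices P ≡ vertices Q ⊎ vertices P ≡ reverse (vertices Q)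

  private
    ≈-sym : ∀ {P Q} → P ≈ Q → Q ≈ P
    ≈-sym (inj₁ e) = inj₁ (sym e)
    ≈-sym (inj₂ e) = inj₂ (trans (sym (reverse-involutive _)) (cong reverse (sym e)))

    ≈-trans : ∀ {P Q R} → P ≈ Q → Q ≈ R → P ≈ R
    ≈-trans (inj₁ e) (inj₁ f) = inj₁ (trans e f)
    ≈-trans (inj₁ e) (inj₂ f) = inj₂ (trans e f)
    ≈-trans (inj₂ e) (inj₁ f) = inj₂ (trans e (cong reverse f))
    ≈-trans (inj₂ e) (inj₂ f) = inj₁ (trans e (trans (cong reverse f) (reverse-involutive _)))

  geodesicPathDecSetoid : DecSetoid 0ℓ 0ℓ
  geodesicPathDecSetoid = record
    { Carrier = GeodesicPath G
    ; _≈_     = _≈_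
    ; isDecEquivalence = record
      { isEquivalence = record
        { refl  = inj₁ refl
        ; sym   = λ {P} {Q} → ≈-sym {P} {Q}
        ; trans = λ {P} {Q} {R} → ≈-trans {P} {Q} {R}
        }
      ; _≟_ = λ P Q → ≡-dec (Graph._≟_ G) (vertices P) (vertices Q)
                ⊎-dec ≡-dec (Graph._≟_ G) (vertices P) (reverse (vertices Q))
      }
    }

  geodesicPathSetoid : Setoid 0ℓ 0ℓ
  geodesicPathSetoid = DecSetoid.setoid geodesicPathDecSetoid

HasCardinality : ∀ {a ℓ} → Setoid a ℓ → ℕ → Set (a ⊔ ℓ)
HasCardinality S t = Bijection (≡.setoid (Fin t)) S

private
  module _ {a ℓ} (S : Setoid a ℓ) where
    open Setoid S using (Carrier) renaming (_≈_ to _∼_; sym to ∼-sym)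

    lookup-injective : ∀ {xs : List Carrier} → UniqueSetoid.Unique S xs →
                       ∀ {i j} → lookup xs i ∼ lookup xs j → i ≡ j
    lookup-injective (_ ∷ _)   {zero}  {zero}  _ = refl
    lookup-injective (x≁ ∷ _)  {zero}  {suc j} e =
      contradiction e (All.lookup x≁ (∈-lookup j))
    lookup-injective (x≁ ∷ _)  {suc i} {zero}  e =
      contradiction (∼-sym e) (All.lookup x≁ (∈-lookup i))
    lookup-injective (_ ∷ xs!) {suc i} {suc j} e = cong suc (lookup-injective xs! e)

  enumeration⇒cardinality : ∀ {a ℓ} (DS : DecSetoid a ℓ) → let S = DecSetoid.setoid DS in
                            ∀ {xs} → IsEnumeration S xs → ∃ (HasCardinality S)
  enumeration⇒cardinality DS {xs} xs-enum = List.length ys , record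
    { to        = lookup ys
    ; cong      = λ { refl → DecSetoid.refl DS }
    ; bijective = lookup-injective S (UniqueDec.deduplicate-! DS xs)
                , lookup-surjective S (deduplicate⁺ DS xs-enum)
    }
    where
    S  = DecSetoid.setoid DS
    ys = deduplicate (DecSetoid._≟_ DS) xs

  module Enumeration (G : Graph) where
    open Graph G

    vertexList : List Vertex
    vertexList = List.map (Inverse.from enumerated) (allFin order)

    vertexList-complete : ∀ v → Any (v ≡_) vertexList
    vertexList-complete v = Anyₚ.map⁺ (Any.map (λ e → trans (sym (Inverse.strictlyInverseʳ enumerated v))
                                                           (cong (Inverse.from enumerated) e))
                                              (∈-allFin (Inverse.to enumerated v)))

    extend : ∀ {u w v} → Dec (Adj u w) → List (Star Adj w v) → List (Star Adj u v)
    extend (yes uw) ps = List.map (uw ◅_) ps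
    extend (no _)   ps = []

    trivial : ∀ {u v} → Dec (u ≡ v) → List (Star Adj u v)
    trivial (yes refl) = ε ∷ []
    trivial (no _)     = []

    walks : ℕ → ∀ u v → List (Star Adj u v)
    walks zero    u v = trivial (u ≟ v)
    walks (suc k) u v = trivial (u ≟ v) List.++
      concatMap (λ w → extend (adj? u w) (walks k w v)) vertexList

    _∼_ : ∀ {u v} → Star Adj u v → Star Adj u v → Set
    p ∼ q = vertexSequence {G} p ≡ vertexSequence {G} q

    trivial-complete : ∀ {u} (d : Dec (u ≡ u)) → Any (ε ∼_) (trivial d)
    trivial-complete (yes refl) = here refl
    trivial-complete (no u≢u)   = contradiction refl u≢u

    extend-complete : ∀ {u w v} (uw : Adj u w) (p : Star Adj w v) (d : Dec (Adj u w)) {ps} →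
                      Any (p ∼_) ps → Any ((uw ◅ p) ∼_) (extend d ps)
    extend-complete uw p (yes _) p∈ = Anyₚ.map⁺ (Any.map (cong (_ ∷_)) p∈)
    extend-complete uw p (no ¬a) _  = contradiction uw ¬a

    walks-complete : ∀ k {u v} (p : Star Adj u v) → length {G} p ≤ k → Any (p ∼_) (walks k u v)
    walks-complete zero    {u} ε _ = trivial-complete (u ≟ u)
    walks-complete (suc k) {u} ε _ = Anyₚ.++⁺ˡ (trivial-complete (u ≟ u))
    walks-complete (suc k) {u} {v} (_◅_ {j = w} uw p) (s≤s le) =
      Anyₚ.++⁺ʳ (trivial (u ≟ v)) (Anyₚ.concatMap⁺ (λ w → extend (adj? u w) (walks k w v))
        (Any.map (λ { refl → extend-complete uw p (adj? u w) (walks-complete k p le) })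
                 (vertexList-complete w)))

    length-vertexSequence : ∀ {u v} (p : Star Adj u v) →
                            List.length (vertexSequence {G} p) ≡ suc (length {G} p)
    length-vertexSequence ε       = refl
    length-vertexSequence (_ ◅ p) = cong suc (length-vertexSequence p)

    ∼⇒length : ∀ {u v} (p q : Star Adj u v) → p ∼ q → length {G} p ≡ length {G} q
    ∼⇒length p q e = ℕ.suc-injective (trans (sym (length-vertexSequence p))
                       (trans (cong List.length e) (length-vertexSequence q)))

    path-length : ∀ {u v} (p : Star Adj u v) → IsPath {G} p → length {G} p ≤ order
    path-length p p! = ℕ.≤-trans (ℕ.n≤1+n _) (subst (_≤ order) (length-vertexSequence p)
      (injective⇒≤ {f = Inverse.to enumerated ∘ lookup (vertexSequence {G} p)}
        (λ e → lookup-injective (≡.setoid Vertex) p! (Injection.injective (↔⇒↣ enumerated) e))))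

    isPath? : ∀ {u v} (p : Star Adj u v) → Dec (IsPath {G} p)
    isPath? p = AllPairs.allPairs? (λ x y → ¬? (x ≟ y)) (vertexSequence {G} p)

    shortest? : ∀ {u v} (p : Star Adj u v) →
                Dec (∀ q → IsPath {G} q → length {G} p ≤ length {G} q)
    shortest? {u} {v} p = map′ sound complete
      (All.all? (λ q → isPath? q →-dec (length {G} p ≤? length {G} q)) (walks order u v))
      where
      Below = λ q → IsPath {G} q → length {G} p ≤ length {G} q
      pick : ∀ q {qs} → IsPath {G} q → All Below qs → Any (q ∼_) qs → length {G} p ≤ length {G} q
      pick q q! (b ∷ _)  (here {x = r} e)  =
        subst (length {G} p ≤_) (sym (∼⇒length q r e)) (b (subst Unique e q!))
      pick q q! (_ ∷ bs) (there i) = pick q q! bs i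
      sound : All Below (walks order u v) → ∀ q → Below q
      sound all q q! = pick q q! all (walks-complete order q (path-length q q!))
      complete : (∀ q → Below q) → All Below (walks order u v)
      complete h = All.universal h _

    isGeodesic? : ∀ {u v} (p : Star Adj u v) → Dec (IsGeodesic {G} p)
    isGeodesic? p = map′
      (λ (a , b , c) → record { isPath = a ; nonempty = b ; shortest = c })
      (λ g → IsGeodesic.isPath g , IsGeodesic.nonempty g , IsGeodesic.shortest g)
      (isPath? p ×-dec (1 ≤? length {G} p) ×-dec shortest? p)

    select : ∀ {u v} (p : Star Adj u v) → Dec (IsGeodesic {G} p) → List (GeodesicPath G)
    select p (yes g) = geodesicPath p g ∷ []
    select p (no _)  = []

    geodesicsFrom : ∀ u v → List (GeodesicPath G)
    geodesicsFrom u v = concatMap (λ p → select p (isGeodesic? p)) (walks order u v)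

    geodesics : List (GeodesicPath G)
    geodesics = concatMap (λ u → concatMap (geodesicsFrom u) vertexList) vertexList

    ∼-geodesic : ∀ {u v} {p q : Star Adj u v} → p ∼ q → IsGeodesic {G} p → IsGeodesic {G} q
    ∼-geodesic {p = p} {q} e g = record
      { isPath   = subst Unique e (IsGeodesic.isPath g)
      ; nonempty = subst (1 ≤_) (∼⇒length p q e) (IsGeodesic.nonempty g)
      ; shortest = λ r r! → subst (_≤ _) (∼⇒length p q e) (IsGeodesic.shortest g r r!)
      }

    select-complete : ∀ P {u v} {q : Star Adj u v} (d : Dec (IsGeodesic {G} q)) → IsGeodesic {G} q →
                      vertices P ≡ vertexSequence {G} q → Any (λ Q → _≈_ G P Q) (select q d)
    select-complete P (yes _) _ e = here (inj₁ e)
    select-complete P (no ¬g) g _ = contradiction g ¬g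

    geodesics-complete : IsEnumeration (geodesicPathSetoid G) geodesics
    geodesics-complete P@(geodesicPath {u} {v} p g) =
      Anyₚ.concatMap⁺ (λ u → concatMap (geodesicsFrom u) vertexList) (Any.map (λ { refl →
        Anyₚ.concatMap⁺ (geodesicsFrom u) (Any.map (λ { refl →
          Anyₚ.concatMap⁺ (λ p → select p (isGeodesic? p)) (Any.map (λ {q} e →
            select-complete P (isGeodesic? q) (∼-geodesic {p = p} {q} e g) e)
          (walks-complete order p (path-length p (IsGeodesic.isPath g)))) })
        (vertexList-complete v)) })
      (vertexList-complete u))

geodesicPaths-finite : ∀ G → ∃ (HasCardinality (geodesicPathSetoid G))
geodesicPaths-finite G =
  enumeration⇒cardinality (geodesicPathDecSetoid G) (Enumeration.geodesics-complete G)

geodesicPathNumber : Graph → ℕ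
geodesicPathNumber G = proj₁ (geodesicPaths-finite G)

IsGeodesicLeechLabeling : ∀ G → EdgeLabeling G → Set
IsGeodesicLeechLabeling G f = ∀ k →
  (∃[ P ] weight f (GeodesicPath.walk {G} P) ≡ k) ⇔ (1 ≤ k × k ≤ geodesicPathNumber G)

IsGeodesicLeechGraph : Graph → Set
IsGeodesicLeechGraph G = ∃ (IsGeodesicLeechLabeling G)

{-# OPTIONS --safe #-}

-- Double counting. Write aᵢⱼ for the label of the edge between the i-th vertex
-- of one side and the j-th vertex of the other, and S for the sum of the labels.
-- The geodesic paths of K(n,n) are its n² edges and its n²(n − 1)
-- paths of length two, so there are n³ of them. An edge lies in 2(n − 1) paths
-- of length two, so the weights add up to (2n − 1) S. For a Leech labeling they
-- also add up to n³ (n³ + 1) / 2, hence 2n − 1 divides n³ (n³ + 1). Modulo 2n − 1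
-- we have 8 n³ ≡ 1, so 64 n³ (n³ + 1) ≡ 1 · (1 + 8) and 2n − 1 divides 9.
module Submission where

open import Defs
import Algebra.Properties.Semiring.Sum
open import Data.Fin.Base as Fin
  using (Fin; zero; suc; toℕ; combine; remQuot; punchIn; punchOut; _↑ˡ_; _↑ʳ_)
open import Data.Fin.Properties as Finₚ
  using (<-cmp; remQuot-combine; combine-remQuot; cantor-schröder-bernstein;
         punchIn-punchOut; punchOut-injective; toℕ-injective; toℕ<n)
open import Data.List.Relation.Unary.All using ([]; _∷_)
open import Data.List.Relation.Unary.AllPairs using ([]; _∷_)
open import Data.Nat.Base using (ℕ; zero; suc; _+_; _*_; _≤_; z≤n; s≤s)
open import Data.Nat.Divisibility using (_∣_; _∣?_; divides; ∣-trans; m∣m*n; n∣m*n;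
         ∣m∣n⇒∣m+n; ∣m+n∣m⇒∣n; >⇒∤)
open import Data.Nat.Properties
  using (+-*-semiring; +-assoc; +-comm; +-identityʳ; +-cancelʳ-≡; +-mono-≤; *-identityʳ;
         m≤m+n; suc-injective)
open import Data.Nat.Tactic.RingSolver using (solve-∀)
open import Data.Product.Base using (∃-syntax; _×_; _,_; proj₁; proj₂)
open import Data.Sum.Base using (inj₁; inj₂)
open import Data.Unit.Base using (tt)
open import Function.Base using (_∘_)
open import Function.Bundles using (Bijection; Equivalence)
open import Function.Definitions using (Injective)
open import Relation.Binary.Bundles using (Setoid)
open import Relation.Binary.Construct.Closure.ReflexiveTransitive using (ε; _◅_)
open import Relation.Binary.Definitions using (Tri; tri<; tri≈; tri>)
open import Relation.Binary.PropositionalEquality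
  using (_≡_; _≢_; refl; sym; trans; cong; cong₂; subst; module ≡-Reasoning)
open import Relation.Nullary using (¬_; contradiction)
open import Relation.Nullary.Decidable using (from-no)

open Algebra.Properties.Semiring.Sum +-*-semiring
  using (sum; sum-cong-≗; ∑-distrib-+; ∑-comm; *-distribˡ-sum; sum-remove)
open ≡-Reasoning

-- Finite sums and the sum of a labeling by 1, ..., n

-- An injective self-map of a finite set is a permutation. The induction removes `zero` from the
-- domain and `g zero` from the codomain; `punchOut` closes the gap, leaving an injective self-map
-- `g′` of `Fin n`.
sum-∘-injective : ∀ {n} (f : Fin n → ℕ) (g : Fin n → Fin n) → Injective _≡_ _≡_ g →
                  sum (f ∘ g) ≡ sum f
sum-∘-injective {zero}  f g g-inj = refl
sum-∘-injective {suc n} f g g-inj = begin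
  f (g zero) + sum (f ∘ g ∘ suc)
    ≡⟨ cong (f (g zero) +_) (sum-cong-≗ (λ i → cong f (punchIn-punchOut (g₀≢ i)))) ⟨
  f (g zero) + sum (f ∘ punchIn (g zero) ∘ g′)
    ≡⟨ cong (f (g zero) +_) (sum-∘-injective (f ∘ punchIn (g zero)) g′ g′-inj) ⟩
  f (g zero) + sum (f ∘ punchIn (g zero))
    ≡⟨ sum-remove {i = g zero} f ⟨
  sum f ∎
  where
  g₀≢ : ∀ i → g zero ≢ g (suc i)
  g₀≢ i e with () ← g-inj e
  g′ : Fin n → Fin n
  g′ i = punchOut (g₀≢ i)
  g′-inj : Injective _≡_ _≡_ g′
  g′-inj e = Finₚ.suc-injective (g-inj (punchOut-injective (g₀≢ _) (g₀≢ _) e))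

sum-const : ∀ n x → sum {n} (λ _ → x) ≡ n * x
sum-const zero    x = refl
sum-const (suc n) x = cong (x +_) (sum-const n x)

-- Gauss's sum, doubled so that no division by two occurs.
sum-suc-toℕ : ∀ n → sum {n} (suc ∘ toℕ) + sum {n} (suc ∘ toℕ) ≡ n * suc n
sum-suc-toℕ zero    = refl
sum-suc-toℕ (suc n) = begin
  suc s′ + suc s′               ≡⟨ cong (λ x → suc x + suc x) shift ⟩
  suc (n + s) + suc (n + s)     ≡⟨ regroup n s ⟩
  suc (suc (n + n)) + (s + s)   ≡⟨ cong (suc (suc (n + n)) +_) (sum-suc-toℕ n) ⟩
  suc (suc (n + n)) + n * suc n ≡⟨ close n ⟩
  suc n * suc (suc n)           ∎
  where
  s s′ : ℕ
  s  = sum {n} (suc ∘ toℕ)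
  s′ = sum {n} (λ i → suc (suc (toℕ i)))
  shift : s′ ≡ n + s
  shift = trans (∑-distrib-+ {n} (λ _ → 1) (λ i → suc (toℕ i)))
                (cong (_+ s) (trans (sum-const n 1) (*-identityʳ n)))
  regroup : ∀ n s → suc (n + s) + suc (n + s) ≡ suc (suc (n + n)) + (s + s)
  regroup = solve-∀
  close : ∀ n → suc (suc (n + n)) + n * suc n ≡ suc n * suc (suc n)
  close = solve-∀

-- Choosing an index for each value gives an injective self-map of `Fin n`, because distinct values
-- need distinct indices. It is therefore a permutation, and `w` is a rearrangement of 1, ..., n.
sum-attaining-range : ∀ {n} (w : Fin n → ℕ) → (∀ k → ∃[ c ] w c ≡ suc (toℕ k)) →
                      sum w + sum w ≡ n * suc n
sum-attaining-range {n} w attains =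
  trans (cong₂ _+_ sum-w sum-w) (sum-suc-toℕ n)
  where
  g : Fin n → Fin n
  g = proj₁ ∘ attains
  g-inj : Injective _≡_ _≡_ g
  g-inj {k} {l} e = toℕ-injective (suc-injective
    (trans (sym (proj₂ (attains k))) (trans (cong w e) (proj₂ (attains l)))))
  sum-w : sum w ≡ sum {n} (suc ∘ toℕ)
  sum-w = trans (sym (sum-∘-injective w g g-inj)) (sum-cong-≗ (proj₂ ∘ attains))

sum-↑ : ∀ m {n} (f : Fin (m + n) → ℕ) → sum f ≡ sum (f ∘ (_↑ˡ n)) + sum (f ∘ (m ↑ʳ_))
sum-↑ zero    f = refl
sum-↑ (suc m) f = trans (cong (f zero +_) (sum-↑ m (f ∘ suc))) (sym (+-assoc (f zero) _ _))

sum-combine : ∀ m {n} (f : Fin (m * n) → ℕ) →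
              sum f ≡ sum {m} (λ i → sum {n} (λ j → f (combine i j)))
sum-combine zero        f = refl
sum-combine (suc m) {n} f =
  trans (sum-↑ n f) (cong (sum (f ∘ (_↑ˡ m * n)) +_) (sum-combine m (f ∘ (n ↑ʳ_))))

-- Total weight of the paths in terms of the label matrix

-- For a labeling a and an index i, take r j = aᵢⱼ and c j = aⱼᵢ. Then the entries
-- above the diagonal are the weights of the paths of length two centred at the
-- i-th vertex of the first side, the entries below it those of the paths centred
-- at the i-th vertex of the second side, and the diagonal is the i-th row of a.
centred : ∀ {n} → (r c : Fin n → ℕ) → Fin n → Fin n → ℕ
centred r c zero    zero    = r zero
centred r c zero    (suc k) = r zero + r (suc k)
centred r c (suc j) zero    = c (suc j) + c zero
centred r c (suc j) (suc k) = centred (r ∘ suc) (c ∘ suc) j k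

centred-< : ∀ {n} {r c : Fin n → ℕ} {j k} → j Fin.< k → centred r c j k ≡ r j + r k
centred-< {j = zero}  {suc k} _       = refl
centred-< {j = suc j} {suc k} (s≤s h) = centred-< h

centred-≡ : ∀ {n} {r c : Fin n → ℕ} j → centred r c j j ≡ r j
centred-≡ zero    = refl
centred-≡ (suc j) = centred-≡ j

centred-> : ∀ {n} {r c : Fin n → ℕ} {j k} → k Fin.< j → centred r c j k ≡ c j + c k
centred-> {j = suc j} {zero}  _       = refl
centred-> {j = suc j} {suc k} (s≤s h) = centred-> h

-- The summand sum c on the left avoids the subtraction in n Σr + (n − 1) Σc.
sum-centred : ∀ {n} (r c : Fin n → ℕ) →
              sum (λ j → sum (λ k → centred r c j k)) + sum c ≡ n * (sum r + sum c)
sum-centred {zero}  r c = refl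
sum-centred {suc n} r c = begin
  ((r₀ + sum (λ k → r₀ + r′ k)) + sum (λ j → (c′ j + c₀) + inner j)) + (c₀ + C)
    ≡⟨ cong₂ (λ x y → ((r₀ + x) + y) + (c₀ + C)) row column ⟩
  ((r₀ + (n * r₀ + R)) + ((C + n * c₀) + M)) + (c₀ + C)
    ≡⟨ regroup n r₀ c₀ R C M ⟩
  (suc n * r₀ + suc n * c₀ + (R + C)) + (M + C)
    ≡⟨ cong ((suc n * r₀ + suc n * c₀ + (R + C)) +_) (sum-centred r′ c′) ⟩
  (suc n * r₀ + suc n * c₀ + (R + C)) + n * (R + C)
    ≡⟨ close n r₀ c₀ R C ⟩
  suc n * ((r₀ + R) + (c₀ + C)) ∎
  where
  r′ c′ inner : Fin n → ℕ
  r′ = r ∘ suc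
  c′ = c ∘ suc
  inner j = sum (λ k → centred r′ c′ j k)
  r₀ c₀ R C M : ℕ
  r₀ = r zero
  c₀ = c zero
  R = sum r′
  C = sum c′
  M = sum inner
  row : sum (λ k → r₀ + r′ k) ≡ n * r₀ + R
  row = trans (∑-distrib-+ {n} (λ _ → r₀) r′) (cong (_+ R) (sum-const n r₀))
  column : sum (λ j → (c′ j + c₀) + inner j) ≡ (C + n * c₀) + M
  column = trans (∑-distrib-+ (λ j → c′ j + c₀) inner)
    (cong (_+ M) (trans (∑-distrib-+ {n} c′ (λ _ → c₀)) (cong (C +_) (sum-const n c₀))))
  regroup : ∀ n r₀ c₀ R C M →
    ((r₀ + (n * r₀ + R)) + ((C + n * c₀) + M)) + (c₀ + C)
      ≡ ((r₀ + n * r₀) + (c₀ + n * c₀) + (R + C)) + (M + C)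
  regroup = solve-∀
  close : ∀ n r₀ c₀ R C →
    ((r₀ + n * r₀) + (c₀ + n * c₀) + (R + C)) + n * (R + C)
      ≡ ((r₀ + R) + (c₀ + C)) + n * ((r₀ + R) + (c₀ + C))
  close = solve-∀

-- The added `S` is also the sum of all column sums, so it splits into one `sum c` for each
-- application of `sum-centred`.
sum-all-centred : ∀ {n} (a : Fin n → Fin n → ℕ) →
  let S = sum (λ i → sum (a i)) in
  sum (λ i → sum (λ j → sum (λ k → centred (a i) (λ l → a l i) j k))) + S ≡ n * (S + S)
sum-all-centred {n} a = begin
  sum T + S                                   ≡⟨ cong (sum T +_) (∑-comm a) ⟩
  sum T + sum C                               ≡⟨ ∑-distrib-+ T C ⟨
  sum (λ i → T i + C i)                       ≡⟨ sum-cong-≗ (λ i → sum-centred (a i) (λ l → a l i)) ⟩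
  sum (λ i → n * (sum (a i) + C i))           ≡⟨ *-distribˡ-sum n (λ i → sum (a i) + C i) ⟨
  n * sum (λ i → sum (a i) + C i)             ≡⟨ cong (n *_) (∑-distrib-+ (sum ∘ a) C) ⟩
  n * (S + sum C)                             ≡⟨ cong (λ x → n * (S + x)) (∑-comm a) ⟨
  n * (S + S)                                 ∎
  where
  S : ℕ
  S = sum (λ i → sum (a i))
  T C : Fin n → ℕ
  T i = sum (λ j → sum (λ k → centred (a i) (λ l → a l i) j k))
  C i = sum (λ l → a l i)

-- Cardinality of a setoid

cardinality-unique : ∀ {a ℓ} (S : Setoid a ℓ) {m n} →
                     HasCardinality S m → HasCardinality S n → m ≡ n
cardinality-unique S F G =
  cantor-schröder-bernstein (into-injective F G) (into-injective G F)
  where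
  module S = Setoid S
  into : ∀ {m n} → HasCardinality S m → HasCardinality S n → Fin m → Fin n
  into F G x = proj₁ (Bijection.surjective G (Bijection.to F x))
  into-injective : ∀ {m n} (F : HasCardinality S m) (G : HasCardinality S n) →
                   Injective _≡_ _≡_ (into F G)
  into-injective F G {x} {y} e = Bijection.injective F
    (S.trans (S.sym (proj₂ (Bijection.surjective G _) refl)) (proj₂ (Bijection.surjective G _) e))

-- Geodesics with one or two edges in an arbitrary graph

module _ {G : Graph} where
  open Graph G

  edge-geodesic : ∀ {u v} (uv : Adj u v) → IsGeodesic {G} (uv ◅ ε)
  edge-geodesic uv = record
    { isPath   = ((λ e → adj-irrefl e uv) ∷ []) ∷ [] ∷ []
    ; nonempty = s≤s z≤n
    ; shortest = λ { ε _ → contradiction uv (adj-irrefl refl) ; (_ ◅ _) _ → s≤s z≤n }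
    }

  two-step-geodesic : ∀ {u w v} (uw : Adj u w) (wv : Adj w v) → u ≢ v → ¬ Adj u v →
                      IsGeodesic {G} (uw ◅ wv ◅ ε)
  two-step-geodesic uw wv u≢v ¬uv = record
    { isPath   = ((λ e → adj-irrefl e uw) ∷ u≢v ∷ []) ∷ ((λ e → adj-irrefl e wv) ∷ []) ∷ [] ∷ []
    ; nonempty = s≤s z≤n
    ; shortest = λ { ε _ → contradiction refl u≢v
                   ; (uv ◅ ε) _ → contradiction uv ¬uv
                   ; (_ ◅ _ ◅ _) _ → s≤s (s≤s z≤n) }
    }

  -- If the ends coincided, the one-vertex path `ε` would be shorter.
  geodesic-ends-distinct : ∀ {u v} {p} → IsGeodesic {G} {u} {v} p → u ≢ v
  geodesic-ends-distinct {p = ε}     g refl with () ← IsGeodesic.nonempty g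
  geodesic-ends-distinct {p = _ ◅ _} g refl with () ← IsGeodesic.shortest g ε ([] ∷ [])

  geodesic-between-adjacent : ∀ {u v} {p} → IsGeodesic {G} {u} {v} p → Adj u v →
                              length {G} p ≤ 1
  geodesic-between-adjacent g uv =
    IsGeodesic.shortest g (uv ◅ ε) (IsGeodesic.isPath (edge-geodesic uv))

  -- Since the ends of a geodesic differ, the walk through `w` is a path and competes with `p`.
  geodesic-with-common-neighbour : ∀ {u w v} {p} → IsGeodesic {G} {u} {v} p →
                                   Adj u w → Adj w v → length {G} p ≤ 2
  geodesic-with-common-neighbour g uw wv = IsGeodesic.shortest g (uw ◅ wv ◅ ε)
    (((λ e → adj-irrefl e uw) ∷ geodesic-ends-distinct g ∷ []) ∷ ((λ e → adj-irrefl e wv) ∷ []) ∷ [] ∷ [])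

-- Geodesic paths of K(n,n) indexed by triples

module _ (n : ℕ) where
  private
    K : Graph
    K = completeBipartite n n

  edge : Fin n → Fin n → GeodesicPath K
  edge i j = geodesicPath {source = inj₁ i} {inj₂ j} (tt ◅ ε) (edge-geodesic tt)

  -- Named after the label matrix: the two edges carry entries of its i-th row.
  row : ∀ i {j k} → j ≢ k → GeodesicPath K
  row i {j} {k} j≢k = geodesicPath {source = inj₂ j} {inj₂ k} (_◅_ {j = inj₁ i} tt (tt ◅ ε))
    (two-step-geodesic tt tt (λ { refl → j≢k refl }) λ())

  column : ∀ i {j k} → j ≢ k → GeodesicPath K
  column i {j} {k} j≢k = geodesicPath {source = inj₁ j} {inj₁ k} (_◅_ {j = inj₂ i} tt (tt ◅ ε))
    (two-step-geodesic tt tt (λ { refl → j≢k refl }) λ())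

  -- The order of `j` and `k` selects the side of the centre, so each unordered pair of distinct
  -- indices serves once for a row and once for a column. The comparison is an explicit argument so
  -- that proofs can match on it directly.
  triplePath′ : ∀ (i j k : Fin n) → Tri (j Fin.< k) (j ≡ k) (k Fin.< j) → GeodesicPath K
  triplePath′ i j k (tri< _ j≢k _) = row i j≢k
  triplePath′ i j k (tri≈ _ _ _)   = edge i j
  triplePath′ i j k (tri> _ j≢k _) = column i j≢k

  triplePath : Fin n × Fin n × Fin n → GeodesicPath K
  triplePath (i , j , k) = triplePath′ i j k (<-cmp j k)

  private
    module ≈ = Setoid (geodesicPathSetoid K)

    -- Paths of different kinds differ in length or in the side of their ends. Within one kind of
    -- two-edge path, a match with the reversal would reverse the order of `j` and `k`.
    triplePath′-injective : ∀ i j k i′ j′ k′ t t′ →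
      _≈_ K (triplePath′ i j k t) (triplePath′ i′ j′ k′ t′) → (i , j , k) ≡ (i′ , j′ , k′)
    triplePath′-injective i j k i′ j′ k′ (tri< _ _ _)  (tri< _ _ _)  (inj₁ refl) = refl
    triplePath′-injective i j k i′ j′ k′ (tri< a _ _)  (tri< b _ _)  (inj₂ refl) =
      contradiction a (Finₚ.<-asym b)
    triplePath′-injective i j k i′ j′ k′ (tri< _ _ _)  (tri≈ _ _ _)  (inj₁ ())
    triplePath′-injective i j k i′ j′ k′ (tri< _ _ _)  (tri≈ _ _ _)  (inj₂ ())
    triplePath′-injective i j k i′ j′ k′ (tri< _ _ _)  (tri> _ _ _)  (inj₁ ())
    triplePath′-injective i j k i′ j′ k′ (tri< _ _ _)  (tri> _ _ _)  (inj₂ ())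
    triplePath′-injective i j k i′ j′ k′ (tri≈ _ refl _) (tri≈ _ refl _) (inj₁ refl) = refl
    triplePath′-injective i j k i′ j′ k′ (tri≈ _ _ _)  (tri≈ _ _ _)  (inj₂ ())
    triplePath′-injective i j k i′ j′ k′ (tri≈ _ _ _)  (tri< _ _ _)  (inj₁ ())
    triplePath′-injective i j k i′ j′ k′ (tri≈ _ _ _)  (tri< _ _ _)  (inj₂ ())
    triplePath′-injective i j k i′ j′ k′ (tri≈ _ _ _)  (tri> _ _ _)  (inj₁ ())
    triplePath′-injective i j k i′ j′ k′ (tri≈ _ _ _)  (tri> _ _ _)  (inj₂ ())
    triplePath′-injective i j k i′ j′ k′ (tri> _ _ _)  (tri> _ _ _)  (inj₁ refl) = refl
    triplePath′-injective i j k i′ j′ k′ (tri> _ _ a)  (tri> _ _ b)  (inj₂ refl) =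
      contradiction a (Finₚ.<-asym b)
    triplePath′-injective i j k i′ j′ k′ (tri> _ _ _)  (tri< _ _ _)  (inj₁ ())
    triplePath′-injective i j k i′ j′ k′ (tri> _ _ _)  (tri< _ _ _)  (inj₂ ())
    triplePath′-injective i j k i′ j′ k′ (tri> _ _ _)  (tri≈ _ _ _)  (inj₁ ())
    triplePath′-injective i j k i′ j′ k′ (tri> _ _ _)  (tri≈ _ _ _)  (inj₂ ())

  triplePath-injective : ∀ s t → _≈_ K (triplePath s) (triplePath t) → s ≡ t
  triplePath-injective (i , j , k) (i′ , j′ , k′) =
    triplePath′-injective i j k i′ j′ k′ (<-cmp j k) (<-cmp j′ k′)

  -- Weights, and every geodesic path as a triple

  edgeWeight : EdgeLabeling K → Fin n → Fin n → ℕ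
  edgeWeight f i j = EdgeLabeling.label f (inj₁ i) (inj₂ j) tt

  module _ (f : EdgeLabeling K) where
    open EdgeLabeling f

    tripleWeight : Fin n × Fin n × Fin n → ℕ
    tripleWeight (i , j , k) = centred (edgeWeight f i) (λ l → edgeWeight f l i) j k

    ⟦_⟧ : GeodesicPath K → ℕ
    ⟦ P ⟧ = weight f (GeodesicPath.walk P)

    -- `_≈_` compares only vertex sequences, so the equality of weights is carried along with it.
    Represents : Fin n × Fin n × Fin n → GeodesicPath K → Set
    Represents s P = _≈_ K (triplePath s) P × tripleWeight s ≡ ⟦ P ⟧

    private
      row-weight : ∀ i {j k} (j≢k : j ≢ k) →
                   ⟦ row i j≢k ⟧ ≡ edgeWeight f i j + edgeWeight f i k
      -- The first edge of the walk leaves the second side, against the orientation of `edgeWeight`;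
      -- in a column it is the second edge.
      row-weight i _ = cong₂ _+_ (label-sym _ _ _) (+-identityʳ _)

      column-weight : ∀ i {j k} (j≢k : j ≢ k) →
                      ⟦ column i j≢k ⟧ ≡ edgeWeight f j i + edgeWeight f k i
      column-weight i _ = cong₂ _+_ refl (trans (+-identityʳ _) (label-sym _ _ _))

      triplePath-edge : ∀ i j t → _≈_ K (triplePath′ i j j t) (edge i j)
      triplePath-edge i j (tri< _ j≢j _) = contradiction refl j≢j
      triplePath-edge i j (tri≈ _ _ _)   = inj₁ refl
      triplePath-edge i j (tri> _ j≢j _) = contradiction refl j≢j

      triplePath-row : ∀ i {j k} (j≢k : j ≢ k) → j Fin.< k → ∀ t →
                       _≈_ K (triplePath′ i j k t) (row i j≢k)
      triplePath-row i _   j<k (tri< _ _ _)   = inj₁ refl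
      triplePath-row i j≢k j<k (tri≈ _ j≡k _) = contradiction j≡k j≢k
      triplePath-row i _   j<k (tri> j≮k _ _) = contradiction j<k j≮k

      triplePath-column : ∀ i {j k} (j≢k : j ≢ k) → k Fin.< j → ∀ t →
                          _≈_ K (triplePath′ i j k t) (column i j≢k)
      triplePath-column i _   k<j (tri< _ _ k≮j) = contradiction k<j k≮j
      triplePath-column i j≢k k<j (tri≈ _ j≡k _) = contradiction j≡k j≢k
      triplePath-column i _   k<j (tri> _ _ _)   = inj₁ refl

    edge-represented : ∀ i j → Represents (i , j , j) (edge i j)
    edge-represented i j =
      triplePath-edge i j (<-cmp j j) , trans (centred-≡ j) (sym (+-identityʳ _))

    row-represented : ∀ i {j k} (j≢k : j ≢ k) → ∃[ s ] Represents s (row i j≢k)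
    row-represented i {j} {k} j≢k with <-cmp j k
    ... | tri≈ _ j≡k _ = contradiction j≡k j≢k
    ... | tri< j<k _ _ = (i , j , k) , triplePath-row i j≢k j<k (<-cmp j k) ,
      trans (centred-< j<k) (sym (row-weight i j≢k))
    -- The triple with `j` and `k` exchanged gives the reversed path, identified with this one by
    -- `inj₂ refl`.
    ... | tri> _ _ k<j = (i , k , j) ,
      ≈.trans {triplePath (i , k , j)} {row i (j≢k ∘ sym)} {row i j≢k}
        (triplePath-row i (j≢k ∘ sym) k<j (<-cmp k j)) (inj₂ refl) ,
      trans (centred-< k<j) (trans (+-comm (edgeWeight f i k) _) (sym (row-weight i j≢k)))

    column-represented : ∀ i {j k} (j≢k : j ≢ k) → ∃[ s ] Represents s (column i j≢k)
    column-represented i {j} {k} j≢k with <-cmp j k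
    ... | tri≈ _ j≡k _ = contradiction j≡k j≢k
    ... | tri> _ _ k<j = (i , j , k) , triplePath-column i j≢k k<j (<-cmp j k) ,
      trans (centred-> k<j) (sym (column-weight i j≢k))
    ... | tri< j<k _ _ = (i , k , j) ,
      ≈.trans {triplePath (i , k , j)} {column i (j≢k ∘ sym)} {column i j≢k}
        (triplePath-column i (j≢k ∘ sym) j<k (<-cmp k j)) (inj₂ refl) ,
      trans (centred-> j<k) (trans (+-comm (edgeWeight f k i) _) (sym (column-weight i j≢k)))

    -- K(n,n) leaves only edges and two-edge paths: ends on opposite sides are adjacent, and ends on
    -- the same side have the second vertex of the walk as a common neighbour.
    represented : ∀ P → ∃[ s ] Represents s P
    represented (geodesicPath ε g) with () ← IsGeodesic.nonempty g
    represented (geodesicPath {inj₁ i} {inj₂ j} (_ ◅ ε) g) = (i , j , j) , edge-represented i j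
    represented P@(geodesicPath {inj₂ j} {inj₁ i} (_ ◅ ε) g) = (i , j , j) ,
      ≈.trans {triplePath (i , j , j)} {edge i j} {P} (proj₁ (edge-represented i j)) (inj₂ refl) ,
      trans (proj₂ (edge-represented i j)) (cong (_+ 0) (label-sym _ _ _))
    represented (geodesicPath {inj₂ j} {inj₂ k} (_◅_ {j = inj₁ i} _ (_ ◅ ε)) g) =
      row-represented i (λ { refl → geodesic-ends-distinct g refl })
    represented (geodesicPath {inj₁ j} {inj₁ k} (_◅_ {j = inj₂ i} _ (_ ◅ ε)) g) =
      column-represented i (λ { refl → geodesic-ends-distinct g refl })
    represented (geodesicPath {inj₁ _} {inj₂ _} (_ ◅ _ ◅ _) g)
      with s≤s () ← geodesic-between-adjacent g tt
    represented (geodesicPath {inj₂ _} {inj₁ _} (_ ◅ _ ◅ _) g)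
      with s≤s () ← geodesic-between-adjacent g tt
    represented (geodesicPath {inj₁ _} {inj₁ _} (_◅_ {j = inj₂ w} _ (_ ◅ _ ◅ _)) g)
      with s≤s (s≤s ()) ← geodesic-with-common-neighbour {w = inj₂ w} g tt tt
    represented (geodesicPath {inj₂ _} {inj₂ _} (_◅_ {j = inj₁ w} _ (_ ◅ _ ◅ _)) g)
      with s≤s (s≤s ()) ← geodesic-with-common-neighbour {w = inj₁ w} g tt tt

  -- Counting the paths and summing the weights of a Leech labeling

  decode : Fin (n * (n * n)) → Fin n × Fin n × Fin n
  decode x = let i , y = remQuot {n} (n * n) x in i , remQuot {n} n y

  encode : Fin n × Fin n × Fin n → Fin (n * (n * n))
  encode (i , j , k) = combine i (combine j k)

  decode-encode : ∀ s → decode (encode s) ≡ s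
  decode-encode (i , j , k) = begin
    decode (combine i (combine j k))
      ≡⟨ cong (λ (i , y) → i , remQuot {n} n y) (remQuot-combine i (combine j k)) ⟩
    (i , remQuot {n} n (combine j k))
      ≡⟨ cong (i ,_) (remQuot-combine j k) ⟩
    (i , j , k) ∎

  encode-decode : ∀ x → encode (decode x) ≡ x
  encode-decode x =
    trans (cong (combine {n} _) (combine-remQuot {n} n _)) (combine-remQuot {n} (n * n) x)

  geodesicPaths-cardinality : EdgeLabeling K → HasCardinality (geodesicPathSetoid K) (n * (n * n))
  geodesicPaths-cardinality f = record
    { to        = triplePath ∘ decode
    ; cong      = λ { refl → inj₁ refl }
    ; bijective =
        (λ {x} {y} e → trans (sym (encode-decode x))
          (trans (cong encode (triplePath-injective (decode x) (decode y) e)) (encode-decode y)))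
      , λ P → let s , s≈P , _ = represented f P in
          encode s , λ { refl → subst (λ t → _≈_ K (triplePath t) P) (sym (decode-encode s)) s≈P }
    }

  -- The path number is the length of a deduplicated enumeration; it is found by comparing two
  -- bijections, not by evaluating that list.
  geodesicPathNumber-K : EdgeLabeling K → geodesicPathNumber K ≡ n * (n * n)
  geodesicPathNumber-K f = cardinality-unique (geodesicPathSetoid K)
    (proj₂ (geodesicPaths-finite K)) (geodesicPaths-cardinality f)

  -- There are as many triples as required weights, and each required weight is attained by a path,
  -- hence by a triple.
  leech-sum : ∀ f → IsGeodesicLeechLabeling K f →
    let T = sum {n} (λ i → sum {n} (λ j → sum {n} (λ k → tripleWeight f (i , j , k)))) in
    T + T ≡ n * (n * n) * suc (n * (n * n))
  leech-sum f leech = subst (λ x → x + x ≡ N * suc N) by-triples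
    (sum-attaining-range (tripleWeight f ∘ decode) attained)
    where
    N : ℕ
    N = n * (n * n)
    attained : ∀ (k : Fin N) → ∃[ c ] tripleWeight f (decode c) ≡ suc (toℕ k)
    attained k = encode s , trans (cong (tripleWeight f) (decode-encode s)) (trans w≡ ⟦P⟧≡)
      where
      found = Equivalence.from (leech (suc (toℕ k)))
        (s≤s z≤n , subst (suc (toℕ k) ≤_) (sym (geodesicPathNumber-K f)) (toℕ<n k))
      P = proj₁ found
      ⟦P⟧≡ = proj₂ found
      s = proj₁ (represented f P)
      w≡ = proj₂ (proj₂ (represented f P))
    by-triples : sum (tripleWeight f ∘ decode) ≡
      sum {n} (λ i → sum {n} (λ j → sum {n} (λ k → tripleWeight f (i , j , k))))
    by-triples = trans (sum-combine n _) (sum-cong-≗ {n} λ i →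
      trans (sum-combine n _) (sum-cong-≗ {n} λ j → sum-cong-≗ {n} λ k →
        cong (tripleWeight f) (decode-encode (i , j , k))))

-- Divisibility and the conclusion

divides-9 : ∀ m → suc (m + m) ∣ (let N = suc m * (suc m * suc m) in N * suc N) → suc (m + m) ∣ 9
divides-9 m d∣ = ∣m+n∣m⇒∣n (subst (d ∣_) (identity m) (∣-trans d∣ (n∣m*n 64))) (m∣m*n q)
  where
  d q : ℕ
  d = suc (m + m)
  q = (d * d + 3 * d + 3) * (8 * (suc m * (suc m * suc m)) + 9)
  -- With x = 8 (m + 1)³ = (d + 1)³ this reads x (x + 8) = (x − 1) (x + 9) + 9,
  -- where x − 1 = d (d² + 3 d + 3).
  identity : ∀ m →
    64 * ((suc m * (suc m * suc m)) * suc (suc m * (suc m * suc m)))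
      ≡ suc (m + m) * ((suc (m + m) * suc (m + m) + 3 * suc (m + m) + 3)
                       * (8 * (suc m * (suc m * suc m)) + 9)) + 9
  identity = solve-∀

leech⇒divides-9 : ∀ m → IsGeodesicLeechGraph (completeBipartite (suc m) (suc m)) → suc (m + m) ∣ 9
leech⇒divides-9 m (f , leech) =
  divides-9 m (subst (suc (m + m) ∣_) (leech-sum (suc m) f leech) d∣T+T)
  where
  a : Fin (suc m) → Fin (suc m) → ℕ
  a = edgeWeight (suc m) f
  S T : ℕ
  S = sum {suc m} (λ i → sum {suc m} (a i))
  T = sum {suc m} (λ i → sum {suc m} (λ j → sum {suc m} (λ k → tripleWeight (suc m) f (i , j , k))))
  regroup : ∀ m S → (S + S) + m * (S + S) ≡ S * suc (m + m) + S
  regroup = solve-∀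
  T≡ : T ≡ S * suc (m + m)
  -- With n = m + 1, `sum-all-centred` reads T + S = 2 n S; cancelling one `S` leaves the factor 2 n
  -- - 1 = 2 m + 1.
  T≡ = +-cancelʳ-≡ S T (S * suc (m + m)) (trans (sum-all-centred a) (regroup m S))
  d∣T+T : suc (m + m) ∣ T + T
  d∣T+T = ∣m∣n⇒∣m+n (divides S T≡) (divides S T≡)

theorem2p7 : (n : ℕ) → 1 ≤ n → n ≢ 1 → n ≢ 2 → n ≢ 5 →
    ¬ IsGeodesicLeechGraph (completeBipartite n n)
theorem2p7 (suc m) _ n≢1 n≢2 n≢5 leech = odd-divisors m (leech⇒divides-9 m leech) n≢1 n≢2 n≢5
  where
  -- The divisors 1, 3 and 9 of 9 occur at m = 0, 1 and 4, which are the excluded values of n.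
  odd-divisors : ∀ m → suc (m + m) ∣ 9 → suc m ≢ 1 → suc m ≢ 2 → ¬ (suc m ≢ 5)
  odd-divisors 0 _ n≢1 _ _ = n≢1 refl
  odd-divisors 1 _ _ n≢2 _ = n≢2 refl
  odd-divisors 2 d∣9 _ _ _ = from-no (5 ∣? 9) d∣9
  odd-divisors 3 d∣9 _ _ _ = from-no (7 ∣? 9) d∣9
  odd-divisors 4 _ _ _ n≢5 = n≢5 refl
  odd-divisors (suc (suc (suc (suc (suc k))))) d∣9 _ _ _ =
    -- Here 2 m is at least 5 + 4, so 2 m + 1 exceeds 9.
    >⇒∤ (s≤s (+-mono-≤ (m≤m+n 5 k) (m≤m+n 4 (suc k)))) d∣9
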